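{- Let $\Gamma$ be a finite simple tetravalent half-arc-transitive graph, with radius $\mathrm{rad}(\Gamma)$ and attachment number $\mathrm{att}(\Gamma)$. If $\mathrm{rad}(\Gamma)$ is odd, then $\mathrm{att}(\Gamma)$ divides $\mathrm{rad}(\Gamma)$. Consequently, if $\mathrm{att}(\Gamma)$ is not divisible by $4$, then $\mathrm{att}(\Gamma)$ divides $\mathrm{rad}(\Gamma)$.
   Context: For a finite simple tetravalent graph $\Gamma$ and $G\le \mathrm{Aut}(\Gamma)$, $\Gamma$ is $G$-half-arc-transitive if $G$ acts transitively on vertices and on edges but not on arcs of $\Gamma$. Then the $G$-orbits on arcs give two paired orientations of the edges; in each, every vertex is the head of two and the tail of two of its incident edges. A $G$-alternating cycle is a cycle in which every two consecutive edges have either a common head or a common tail (with respect to such an orientation). All $G$-alternating cycles have the same even length $2\mathrm{rad}_G(\Gamma)$ ($\mathrm{rad}_G(\Gamma)$ is the $G$-radius), each edge lies in exactly one and each vertex in exactly two $G$-alternating cycles, and any two non-disjoint $G$-alternating cycles meet in the same number $\mathrm{att}_G(\Gamma)$ of vertices (the $G$-attachment number). The graph $\Gamma$ is called half-arc-transitive if $\mathrm{Aut}(\Gamma)$ itself is half-arc-transitive; then $\mathrm{rad}(\Gamma)=\mathrm{rad}_{\mathrm{Aut}(\Gamma)}(\Gamma)$ and $\mathrm{att}(\Gamma)=\mathrm{att}_{\mathrm{Aut}(\Gamma)}(\Gamma)$. -}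

module Defs where

open import Data.Nat using (ℕ; zero; suc; _+_; _*_; _≤_; _<_)
open import Data.Fin using (Fin)
open import Data.Fin.Permutation using (Permutation′; _⟨$⟩ʳ_)
open import Data.Bool using (Bool; true; false)
open import Data.Product using (Σ; ∃; ∃-syntax; _×_; _,_)
open import Data.Sum using (_⊎_)
open import Relation.Nullary using (¬_)
open import Relation.Binary.PropositionalEquality using (_≡_; _≢_)
open import Function.Bundles using (_⇔_)

record Graph (n : ℕ) : Set where
  field
    adj      : Fin n → Fin n → Bool
    adj-sym  : ∀ u v → adj u v ≡ adj v u
    adj-irr  : ∀ v → adj v v ≡ false

module _ {n : ℕ} (Γ : Graph n) where
  open Graph Γ

  E : Fin n → Fin n → Set
  E u v = adj u v ≡ true

  Tetravalent : Set
  Tetravalent = ∀ v → Σ (Fin 4 → Fin n) λ w →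
      (∀ i j → w i ≡ w j → i ≡ j)
    × (∀ x → E v x ⇔ (∃[ i ] w i ≡ x))

  IsAut : Permutation′ n → Set
  IsAut σ = ∀ u v → E u v ⇔ E (σ ⟨$⟩ʳ u) (σ ⟨$⟩ʳ v)

  VertexTransitive : Set
  VertexTransitive = ∀ u v → ∃[ σ ] (IsAut σ × σ ⟨$⟩ʳ u ≡ v)

  EdgeTransitive : Set
  EdgeTransitive = ∀ u v x y → E u v → E x y → ∃[ σ ] (IsAut σ ×
    ((σ ⟨$⟩ʳ u ≡ x × σ ⟨$⟩ʳ v ≡ y) ⊎ (σ ⟨$⟩ʳ u ≡ y × σ ⟨$⟩ʳ v ≡ x)))

  ArcTransitive : Set
  ArcTransitive = ∀ u v x y → E u v → E x y → ∃[ σ ] (IsAut σ ×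
    (σ ⟨$⟩ʳ u ≡ x × σ ⟨$⟩ʳ v ≡ y))

  HalfArcTransitive : Set
  HalfArcTransitive = VertexTransitive × EdgeTransitive × ¬ ArcTransitive

  -- The orientation determined by the Aut(Γ)-orbit of the arc (u₀,v₀):
  -- u → v iff (u,v) lies in the Aut(Γ)-orbit of (u₀,v₀).
  Arc : (u₀ v₀ : Fin n) → Fin n → Fin n → Set
  Arc u₀ v₀ u v = ∃[ σ ] (IsAut σ × σ ⟨$⟩ʳ u₀ ≡ u × σ ⟨$⟩ʳ v₀ ≡ v)

  -- An alternating cycle of length 2r w.r.t. the orientation given by (u₀,v₀),
  -- presented as a 2r-periodic vertex sequence c : ℕ → Fin n, injective on one
  -- period, whose consecutive edges alternate in direction:
  --   c(2j) → c(2j+1) ← c(2j+2).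
  -- (Every alternating cycle can be written so, after shifting the start.)
  record AltCycle (u₀ v₀ : Fin n) (r : ℕ) : Set where
    field
      c        : ℕ → Fin n
      r≥2      : 2 ≤ r
      periodic : ∀ i → c (i + 2 * r) ≡ c i
      inj      : ∀ i j → i < 2 * r → j < 2 * r → c i ≡ c j → i ≡ j
      fwd      : ∀ j → Arc u₀ v₀ (c (2 * j)) (c (suc (2 * j)))
      bwd      : ∀ j → Arc u₀ v₀ (c (suc (suc (2 * j)))) (c (suc (2 * j)))

  open AltCycle

  OnCycle : ∀ {u₀ v₀ r} → AltCycle u₀ v₀ r → Fin n → Set
  OnCycle {r = r} C x = ∃[ i ] (i < 2 * r × c C i ≡ x)

  -- C and D have no common edge (i.e. are distinct alternating cycles)
  EdgeDisjoint : ∀ {u₀ v₀ r} → AltCycle u₀ v₀ r → AltCycle u₀ v₀ r → Set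
  EdgeDisjoint C D = ∀ i j →
      ¬ (c C i ≡ c D j × c C (suc i) ≡ c D (suc j))
    × ¬ (c C i ≡ c D (suc j) × c C (suc i) ≡ c D j)

  -- rad(Γ) = r: the alternating cycles (all of the same length) have length 2r
  IsRadius : (u₀ v₀ : Fin n) → ℕ → Set
  IsRadius u₀ v₀ r = AltCycle u₀ v₀ r

  IsAttachment : (u₀ v₀ : Fin n) → ℕ → Set
  IsAttachment u₀ v₀ a = ∃[ r ] Σ (AltCycle u₀ v₀ r) λ C → Σ (AltCycle u₀ v₀ r) λ D →
      EdgeDisjoint C D
    × (∃[ x ] (OnCycle C x × OnCycle D x))
    × Σ (Fin a → Fin n) λ w →
        (∀ i j → w i ≡ w j → i ≡ j)
      × (∀ x → (OnCycle C x × OnCycle D x) ⇔ (∃[ i ] w i ≡ x))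

{-# OPTIONS --safe #-}
module Submission where

-- Let C and D be two alternating cycles meeting in x = C₀ = D₀, where x is a tail on C and a
-- head on D.  The automorphisms preserving C and D make S = { k | C_k lies on D } a subgroup dℤ
-- of ℤ containing 2r, whence a d = 2r.  If d is even then a ∣ r; if d is odd and r is even then 4 ∣ a.
-- If d and r are both odd then r ∈ S, and a reflection fixing x shows that the antipodes of
-- x on C and on D coincide.  The map sending every vertex to its antipode is then well defined on
-- all of Γ, and it is an automorphism that reverses every arc because r is odd: a contradiction.

open import Defs
open import Data.Bool using (Bool; true; false; not)
open import Data.Bool.Properties using (not-involutive; ¬-not)
open import Data.Empty using (⊥; ⊥-elim)
open import Data.Fin using (Fin; toℕ; fromℕ<)
open import Data.Fin.Permutation using (Permutation′; permutation; _⟨$⟩ʳ_; _⟨$⟩ˡ_; flip; _∘ₚ_; inverseʳ; inverseˡ)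
open import Data.Fin.Properties using (_≟_; any?; injective⇒≤; cantor-schröder-bernstein; toℕ-injective; toℕ<n; toℕ-fromℕ<)
open import Data.Nat using (ℕ; zero; suc; pred; _+_; _*_; _≤_; _<_; _%_; _/_; NonZero; z≤n; s≤s; >-nonZero)
open import Data.Nat.Divisibility using (_∣_; _∤_; divides; ∣-antisym; >⇒∤; ∣m+n∣m⇒∣n; m∣m*n; n∣m*n; m%n≡0⇒n∣m; ∣-trans; *-monoʳ-∣; *-cancelˡ-∣)
open import Data.Nat.DivMod using (m≡m%n+[m/n]*n; m%n<n)
open import Data.Nat.Induction using (<-rec)
open import Data.Nat.Properties using (*-assoc; *-cancelʳ-<; *-cancelʳ-≡; *-cancelˡ-≡; *-comm; *-distribʳ-+; *-identityˡ; *-monoʳ-≤; *-monoˡ-<; *-suc; +-assoc; +-cancelˡ-≡; +-comm; +-identityʳ; <-irrefl; _<?_; anyUpTo?; m<m+n; m≤m+n; m≤n+m; m≤n⇒∃[o]m+o≡n; suc-pred; ≤-<-trans; ≤-refl; ≤-total; ≤-trans)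
open import Data.Product using (∃-syntax; _×_; _,_; proj₁; proj₂)
open import Data.Sum using (_⊎_; inj₁; inj₂)
open import Data.Vec using (Vec; []; _∷_; lookup)
open import Data.Vec.Membership.Propositional.Properties using (∈-lookup)
open import Data.Vec.Relation.Unary.All as All using (All; []; _∷_)
open import Data.Vec.Relation.Unary.AllPairs using ([]; _∷_)
open import Data.Vec.Relation.Unary.Unique.Propositional using (Unique)
open import Data.Vec.Relation.Unary.Unique.Propositional.Properties using (lookup-injective)
open import Function using (_∘_; _⇔_; mk⇔; Equivalence)
open import Relation.Binary.PropositionalEquality using (_≡_; _≢_; refl; sym; trans; cong; subst; subst₂; module ≡-Reasoning)
open import Relation.Nullary using (¬_; Dec; yes; no; contradiction)
open import Relation.Nullary.Decidable using (_×-dec_) renaming (map′ to mapDec)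
open Equivalence using (to; from)

-- Parity and the final divisibility argument

parity-cases : ∀ k → (∃[ q ] k ≡ 2 * q) ⊎ (∃[ q ] k ≡ 1 + 2 * q)
parity-cases zero = inj₁ (0 , refl)
parity-cases (suc k) with parity-cases k
... | inj₁ (q , refl) = inj₂ (q , refl)
... | inj₂ (q , refl) = inj₁ (suc q , sym (*-suc 2 q))

odd-form : ∀ {k} → 2 ∤ k → ∃[ q ] k ≡ 1 + 2 * q
odd-form {k} ¬2∣k with parity-cases k
... | inj₁ (q , refl) = contradiction (m∣m*n q) ¬2∣k
... | inj₂ h = h

2∣odd-multiple : ∀ {m} q → 2 ∣ m * (1 + 2 * q) → 2 ∣ m
2∣odd-multiple {m} q 2∣ = ∣m+n∣m⇒∣n
  (subst (2 ∣_) (trans (*-suc m (2 * q)) (+-comm m (m * (2 * q)))) 2∣)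
  (∣-trans (m∣m*n q) (n∣m*n m))

-- If `d = 2 * q`, then `a * q = r`. If `d` is odd, then `r` is even, so 4 divides `a * d` and hence
-- `a`.
dichotomy : ∀ {a d r} → a * d ≡ 2 * r → (2 ∤ d → 2 ∤ r → ⊥) → (2 ∤ r → a ∣ r) × (4 ∤ a → a ∣ r)
dichotomy {a} {d} {r} ad≡2r not-both-odd with parity-cases d
... | inj₁ (q , refl) = (λ _ → a∣r) , (λ _ → a∣r)
  where
  a∣r : a ∣ r
  a∣r = divides q (*-cancelˡ-≡ r (q * a) 2 (trans (sym ad≡2r)
    (trans (*-comm a (2 * q)) (*-assoc 2 q a))))
... | inj₂ (q , refl) = (λ r-odd → ⊥-elim (not-both-odd d-odd r-odd)) ,
                        (λ 4∤a → ⊥-elim (not-both-odd d-odd (λ 2∣r → 4∤a (4∣a 2∣r))))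
  where
  d-odd : 2 ∤ 1 + 2 * q
  d-odd 2∣d = >⇒∤ ≤-refl (∣m+n∣m⇒∣n (subst (2 ∣_) (+-comm 1 (2 * q)) 2∣d) (m∣m*n q))
  4∣a : 2 ∣ r → 4 ∣ a
  4∣a 2∣r with 2∣odd-multiple {a} q (subst (2 ∣_) (sym ad≡2r) (m∣m*n r))
  ... | divides h refl = subst (4 ∣_) (*-comm 2 h) (*-monoʳ-∣ 2 (2∣odd-multiple {h} q
    (subst (2 ∣_) (sym half) 2∣r)))
    where
    half : h * (1 + 2 * q) ≡ r
    half = *-cancelˡ-≡ _ r 2 (trans (sym (*-assoc 2 h (1 + 2 * q)))
      (trans (cong (_* (1 + 2 * q)) (*-comm 2 h)) ad≡2r))

-- Subgroups of ℤ and their elements in one period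

least : {P : ℕ → Set} → (∀ k → Dec (P k)) → ∀ m → P m →
        ∃[ d ] (P d × (∀ k → k < d → ¬ P k))
least {P} P? = <-rec (λ m → P m → ∃[ d ] (P d × (∀ k → k < d → ¬ P k))) search
  where
  search : ∀ m → (∀ {k} → k < m → P k → ∃[ d ] (P d × (∀ k → k < d → ¬ P k))) →
           P m → ∃[ d ] (P d × (∀ k → k < d → ¬ P k))
  search m rec Pm with anyUpTo? P? m
  ... | yes (k , k<m , Pk) = rec k<m Pk
  ... | no none = m , Pm , λ k k<m Pk → none (k , k<m , Pk)

-- Without subtraction, a subgroup of ℤ containing N is an additively closed set of
-- naturals that is invariant under translation by N in both directions.
subgroup-generator : {P : ℕ → Set} → (∀ k → Dec (P k)) → (N : ℕ) → 0 < N → P 0 → P N →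
  (∀ k l → P k → P l → P (k + l)) → (∀ k q → P (k + q * N) → P k) →
  ∃[ d ] (0 < d × P d × (∀ k → P k → d ∣ k))
subgroup-generator {P} P? N 0<N P0 PN P+ Pmod
  with least (λ k → (0 <? k) ×-dec P? k) N (0<N , PN)
... | d , (0<d , Pd) , minimal = d , 0<d , Pd , generates
  where
  instance
    d≢0 : NonZero d
    d≢0 = >-nonZero 0<d

  multiple : ∀ q {k} → P k → P (q * k)
  multiple zero Pk = P0
  multiple (suc q) {k} Pk = P+ k (q * k) Pk (multiple q Pk)

  M = pred N

  M+1≡N : suc M ≡ N
  M+1≡N = suc-pred N {{>-nonZero 0<N}}

  -- As `M` is -1 modulo `N`, adding `M` times `k / d * d` subtracts it from `k`, up to a multiple
  -- of `N` that `Pmod` removes.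
  cancel : ∀ k → k + (k / d * d) * M ≡ k % d + (k / d * d) * N
  cancel k = begin
    k + Q * M            ≡⟨ cong (_+ Q * M) (m≡m%n+[m/n]*n k d) ⟩
    k % d + Q + Q * M    ≡⟨ +-assoc (k % d) Q (Q * M) ⟩
    k % d + (Q + Q * M)  ≡⟨ cong (k % d +_) (*-suc Q M) ⟨
    k % d + Q * suc M    ≡⟨ cong (λ z → k % d + Q * z) M+1≡N ⟩
    k % d + Q * N        ∎
    where
    open ≡-Reasoning
    Q = k / d * d

  remainder : ∀ k → P k → P (k % d)
  remainder k Pk = Pmod (k % d) (k / d * d) (subst P (cancel k)
    (P+ k _ Pk (subst P (*-comm M (k / d * d)) (multiple M (multiple (k / d) Pd)))))

  generates : ∀ k → P k → d ∣ k
  generates k Pk with k % d in eq | remainder k Pk | m%n<n k d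
  ... | zero  | _  | _  = m%n≡0⇒n∣m k d eq
  ... | suc s | Ps | lt = contradiction (s≤s z≤n , Ps) (minimal (suc s) lt)

-- Injections in both directions: `slot` divides the position of `w i` by `d`, and `q` goes to the
-- `w`-index of `f (q * d)`.
count-multiples : {A : Set} {a N : ℕ} (f : ℕ → A) (w : Fin a → A) (d e : ℕ) .{{_ : NonZero d}} →
  N ≡ e * d → (∀ {i j} → i < N → j < N → f i ≡ f j → i ≡ j) → (∀ {i j} → w i ≡ w j → i ≡ j) →
  (∀ q → ∃[ i ] w i ≡ f (q * d)) → (∀ i → ∃[ k ] (k < N × d ∣ k × f k ≡ w i)) → a ≡ e
count-multiples {a = a} f w d e refl f-inj w-inj index position =
  cantor-schröder-bernstein {f = proj₁ ∘ slot} {g = λ q → proj₁ (index (toℕ q))}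
    (λ {i} {j} eq → w-inj (trans (sym (proj₂ (slot i)))
      (trans (cong (λ q → f (toℕ q * d)) eq) (proj₂ (slot j)))))
    (λ {p} {q} eq → toℕ-injective (*-cancelʳ-≡ (toℕ p) (toℕ q) d (f-inj (below p) (below q)
      (trans (sym (proj₂ (index (toℕ p)))) (trans (cong w eq) (proj₂ (index (toℕ q))))))))
  where
  below : ∀ (q : Fin e) → toℕ q * d < e * d
  below q = *-monoˡ-< d (toℕ<n q)

  slot : ∀ i → ∃[ q ] f (toℕ {e} q * d) ≡ w i
  slot i with position i
  ... | _ , k<ed , divides q refl , fk≡wi =
    fromℕ< q<e , trans (cong (λ z → f (z * d)) (toℕ-fromℕ< q<e)) fk≡wi
    where
    q<e : q < e
    q<e = *-cancelʳ-< d q e k<ed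

-- Periodic sequences

module _ {A : Set} {N : ℕ} (f : ℕ → A) where

  periodic-multiple : (∀ k → f (k + N) ≡ f k) → ∀ k q → f (k + q * N) ≡ f k
  periodic-multiple period k zero = cong f (+-identityʳ k)
  periodic-multiple period k (suc q) = begin
    f (k + (N + q * N))  ≡⟨ cong (λ z → f (k + z)) (+-comm N (q * N)) ⟩
    f (k + (q * N + N))  ≡⟨ cong f (+-assoc k (q * N) N) ⟨
    f (k + q * N + N)    ≡⟨ period (k + q * N) ⟩
    f (k + q * N)        ≡⟨ periodic-multiple period k q ⟩
    f k                  ∎
    where open ≡-Reasoning

  periodic-% : .{{_ : NonZero N}} → (∀ k → f (k + N) ≡ f k) → ∀ k → f (k % N) ≡ f k
  periodic-% period k = sym (trans (cong f (m≡m%n+[m/n]*n k N))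
    (periodic-multiple period (k % N) (k / N)))

  periodic-reduce : .{{_ : NonZero N}} → (∀ k → f (k + N) ≡ f k) → ∀ k → ∃[ l ] (l < N × f l ≡ f k)
  periodic-reduce period k = k % N , m%n<n k N , periodic-% period k

  -- Injectivity on one period gives `k + i` and `i` equal remainders. Phrased through differences
  -- of indices, it is stable under shifts.
  periodic-faithful : .{{_ : NonZero N}} → (∀ k → f (k + N) ≡ f k) →
    (∀ i j → i < N → j < N → f i ≡ f j → i ≡ j) → ∀ k i → f (k + i) ≡ f i → N ∣ k
  periodic-faithful period inj k i eq = ∣m+n∣m⇒∣n
    (subst (N ∣_) (+-cancelˡ-≡ (i % N) _ _ indices) (n∣m*n ((k + i) / N)))
    (n∣m*n (i / N))
    where
    remainders : (k + i) % N ≡ i % N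
    remainders = inj _ _ (m%n<n (k + i) N) (m%n<n i N)
      (trans (periodic-% period (k + i)) (trans eq (sym (periodic-% period i))))

    indices : i % N + (k + i) / N * N ≡ i % N + (i / N * N + k)
    indices = begin
      i % N + (k + i) / N * N        ≡⟨ cong (_+ (k + i) / N * N) remainders ⟨
      (k + i) % N + (k + i) / N * N  ≡⟨ m≡m%n+[m/n]*n (k + i) N ⟨
      k + i                          ≡⟨ +-comm k i ⟩
      i + k                          ≡⟨ cong (_+ k) (m≡m%n+[m/n]*n i N) ⟩
      i % N + i / N * N + k          ≡⟨ +-assoc (i % N) (i / N * N) k ⟩
      i % N + (i / N * N + k)        ∎
      where open ≡-Reasoning

-- Alternation of tails and heads

-- Tells whether position `k` is a tail (`true`) or a head when position 0 is of type `b`.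
phase : Bool → ℕ → Bool
phase b zero = b
phase b (suc k) = not (phase b k)

phase-+ : ∀ b k m → phase b (k + m) ≡ phase (phase b m) k
phase-+ b zero m = refl
phase-+ b (suc k) m = cong not (phase-+ b k m)

phase-not : ∀ b k → phase (not b) k ≡ not (phase b k)
phase-not b zero = refl
phase-not b (suc k) = cong not (phase-not b k)

phase-cancel : ∀ b k → phase (phase b k) k ≡ b
phase-cancel b zero = refl
phase-cancel b (suc k) = begin
  not (phase (not (phase b k)) k)  ≡⟨ cong not (phase-not (phase b k) k) ⟩
  not (not (phase (phase b k) k))  ≡⟨ not-involutive _ ⟩
  phase (phase b k) k              ≡⟨ phase-cancel b k ⟩
  b                                ∎
  where open ≡-Reasoning

phase-even : ∀ b q → phase b (2 * q) ≡ b
phase-even b q rewrite +-identityʳ q = trans (phase-+ b q q) (phase-cancel b q)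

phase-odd : ∀ b {r} → 2 ∤ r → phase b r ≡ not b
phase-odd b odd with odd-form odd
... | q , refl = cong not (phase-even b q)

-- Automorphisms and the induced orientation

module _ {n : ℕ} (Γ : Graph n) where

  aut-∘ : ∀ {σ τ} → IsAut Γ σ → IsAut Γ τ → IsAut Γ (σ ∘ₚ τ)
  aut-∘ {σ} σ-aut τ-aut u v = mk⇔
    (to (τ-aut _ _) ∘ to (σ-aut u v))
    (from (σ-aut u v) ∘ from (τ-aut _ _))

  aut-flip : ∀ {σ} → IsAut Γ σ → IsAut Γ (flip σ)
  aut-flip {σ} σ-aut u v = mk⇔
    (λ e → from (σ-aut _ _) (subst₂ (E Γ) (sym (inverseʳ σ)) (sym (inverseʳ σ)) e))
    (λ e → subst₂ (E Γ) (inverseʳ σ) (inverseʳ σ) (to (σ-aut _ _) e))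

module Orientation {n : ℕ} (Γ : Graph n) (tetravalent : Tetravalent Γ)
  (hat : HalfArcTransitive Γ) (u₀ v₀ : Fin n) (e₀ : E Γ u₀ v₀) where

  infix 4 _⟶_

  _⟶_ : Fin n → Fin n → Set
  u ⟶ v = Arc Γ u₀ v₀ u v

  act-arc : ∀ {σ u v} → IsAut Γ σ → u ⟶ v → (σ ⟨$⟩ʳ u) ⟶ (σ ⟨$⟩ʳ v)
  act-arc {σ} σ-aut (ρ , ρ-aut , refl , refl) = ρ ∘ₚ σ , aut-∘ Γ {ρ} {σ} ρ-aut σ-aut , refl , refl

  arc-edge : ∀ {u v} → u ⟶ v → E Γ u v
  arc-edge (σ , σ-aut , refl , refl) = to (σ-aut u₀ v₀) e₀

  arc-transitive : ∀ {u v x y} → u ⟶ v → x ⟶ y →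
                   ∃[ σ ] (IsAut Γ σ × σ ⟨$⟩ʳ u ≡ x × σ ⟨$⟩ʳ v ≡ y)
  arc-transitive (σ , σ-aut , refl , refl) (ρ , ρ-aut , refl , refl) =
    flip σ ∘ₚ ρ , aut-∘ Γ {flip σ} {ρ} (aut-flip Γ {σ} σ-aut) ρ-aut ,
    cong (ρ ⟨$⟩ʳ_) (inverseˡ σ) , cong (ρ ⟨$⟩ʳ_) (inverseˡ σ)

  oriented : ∀ {u v} → E Γ u v → u ⟶ v ⊎ v ⟶ u
  oriented {u} {v} e with proj₁ (proj₂ hat) u₀ v₀ u v e₀ e
  ... | σ , σ-aut , inj₁ h = inj₁ (σ , σ-aut , h)
  ... | σ , σ-aut , inj₂ h = inj₂ (σ , σ-aut , h)

  -- An orbit containing one arc and its reverse would contain every arc, making the graph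
  -- arc-transitive.
  arc-asym : ∀ {u v} → u ⟶ v → v ⟶ u → ⊥
  arc-asym u⟶v v⟶u = proj₂ (proj₂ hat) λ _ _ _ _ e e′ → arc-transitive (arc e) (arc e′)
    where
    arc : ∀ {x y} → E Γ x y → x ⟶ y
    arc e with oriented e
    ... | inj₁ x⟶y = x⟶y
    ... | inj₂ y⟶x with arc-transitive u⟶v y⟶x
    ... | σ , σ-aut , refl , refl = act-arc {σ} σ-aut v⟶u

  -- The Boolean lets one argument serve both tails and heads.
  Step : Bool → Fin n → Fin n → Set
  Step true  u v = u ⟶ v
  Step false u v = v ⟶ u

  step-flip : ∀ {b u v} → Step b u v → Step (not b) v u
  step-flip {true}  s = s
  step-flip {false} s = s

  step-edge : ∀ {b u v} → Step b u v → E Γ u v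
  step-edge {true}  s = arc-edge s
  step-edge {false} s = trans (Graph.adj-sym Γ _ _) (arc-edge s)

  step-asym : ∀ {b u v w} → Step b u v → Step (not b) u w → v ≢ w
  step-asym {true}  s t refl = arc-asym s t
  step-asym {false} s t refl = arc-asym s t

  act-step : ∀ {b σ u v} → IsAut Γ σ → Step b u v → Step b (σ ⟨$⟩ʳ u) (σ ⟨$⟩ʳ v)
  act-step {true}  {σ} σ-aut s = act-arc {σ} σ-aut s
  act-step {false} {σ} σ-aut s = act-arc {σ} σ-aut s

  step-transitive : ∀ {b u v x y} → Step b u v → Step b x y →
                    ∃[ σ ] (IsAut Γ σ × σ ⟨$⟩ʳ u ≡ x × σ ⟨$⟩ʳ v ≡ y)
  step-transitive {true}  s t = arc-transitive s t
  step-transitive {false} s t with arc-transitive s t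
  ... | σ , σ-aut , p , q = σ , σ-aut , q , p

  perm-injective : ∀ (σ : Permutation′ n) {x y} → σ ⟨$⟩ʳ x ≡ σ ⟨$⟩ʳ y → x ≡ y
  perm-injective σ eq = trans (sym (inverseˡ σ)) (trans (cong (σ ⟨$⟩ˡ_) eq) (inverseˡ σ))

  -- Valency 4 enters here: five distinct neighbours would inject `Fin 5` into `Fin 4`.
  no-five-neighbours : ∀ {y} (xs : Vec (Fin n) 5) → Unique xs → All (E Γ y) xs → ⊥
  no-five-neighbours {y} xs unique adjacent =
    <-irrefl refl (injective⇒≤ {f = proj₁ ∘ index} λ {i} {j} eq → lookup-injective unique i j
      (trans (sym (proj₂ (index i))) (trans (cong (proj₁ (tetravalent y)) eq) (proj₂ (index j)))))
    where
    index : ∀ i → ∃[ j ] proj₁ (tetravalent y) j ≡ lookup xs i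
    index i = to (proj₂ (proj₂ (tetravalent y)) _) (All.lookup adjacent (∈-lookup i xs))

  -- Alternating cycles: shifts, images and reversal

  -- Unlike AltCycle, stable under odd shifts: b says whether f 0 is a tail (true) or a head (false).
  record Cycle (r : ℕ) (b : Bool) (f : ℕ → Fin n) : Set where
    field
      2≤r       : 2 ≤ r
      steps     : ∀ k → Step (phase b k) (f k) (f (suc k))
      period    : ∀ k → f (k + 2 * r) ≡ f k
      faithful  : ∀ k i → f (k + i) ≡ f i → 2 * r ∣ k

    4≤2r : 4 ≤ 2 * r
    4≤2r = *-monoʳ-≤ 2 2≤r

    0<2r : 0 < 2 * r
    0<2r = ≤-trans (s≤s z≤n) 4≤2r

    periods : ∀ k q → f (k + q * (2 * r)) ≡ f k
    periods = periodic-multiple f period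

    -- The index − 1 modulo 2r.
    M : ℕ
    M = pred (2 * r)

    M+1≡2r : suc M ≡ 2 * r
    M+1≡2r = suc-pred (2 * r) {{>-nonZero 0<2r}}

    k+kM : ∀ k → k + k * M ≡ k * (2 * r)
    k+kM k = trans (sym (*-suc k M)) (cong (k *_) M+1≡2r)

    no-backtrack : ∀ k → f k ≢ f (suc (suc k))
    no-backtrack k eq = >⇒∤ (≤-trans (s≤s (s≤s (s≤s z≤n))) 4≤2r) (faithful 2 k (sym eq))

    step-back : ∀ k → Step (phase b (suc k)) (f (suc k)) (f k)
    step-back k = step-flip (steps k)

    phase-M : phase b M ≡ not b
    phase-M = trans (sym (not-involutive _)) (cong not (trans (cong (phase b) M+1≡2r) (phase-even b r)))

    reduce : ∀ k → ∃[ l ] (l < 2 * r × f l ≡ f k)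
    reduce = periodic-reduce f {{>-nonZero 0<2r}} period

    injective-≤ : ∀ {i j} → i ≤ j → j < 2 * r → f i ≡ f j → i ≡ j
    injective-≤ {i} i≤j j<2r eq with m≤n⇒∃[o]m+o≡n i≤j
    ... | zero  , refl = sym (+-identityʳ i)
    ... | suc k , refl = contradiction
      (faithful (suc k) i (trans (cong f (+-comm (suc k) i)) (sym eq)))
      (>⇒∤ (≤-<-trans (m≤n+m (suc k) i) j<2r))

    injective : ∀ {i j} → i < 2 * r → j < 2 * r → f i ≡ f j → i ≡ j
    injective {i} {j} i<2r j<2r eq with ≤-total i j
    ... | inj₁ i≤j = injective-≤ i≤j j<2r eq
    ... | inj₂ j≤i = sym (injective-≤ j≤i i<2r (sym eq))

  open Cycle

  module _ {r b f} (F : Cycle r b f) where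

    shift : ∀ m → Cycle r (phase b m) (λ k → f (k + m))
    shift m = record
      { 2≤r = 2≤r F
      ; steps = λ k → subst (λ c → Step c _ _) (phase-+ b k m) (steps F (k + m))
      ; period = λ k → trans (cong f (rearrange k)) (period F (k + m))
      ; faithful = λ k i eq → faithful F k (i + m) (trans (cong f (sym (+-assoc k i m))) eq) }
      where
      rearrange : ∀ k → k + 2 * r + m ≡ k + m + 2 * r
      rearrange k = trans (+-assoc k (2 * r) m)
        (trans (cong (k +_) (+-comm (2 * r) m)) (sym (+-assoc k m (2 * r))))

    act : ∀ {σ} → IsAut Γ σ → Cycle r b (λ k → σ ⟨$⟩ʳ f k)
    act {σ} σ-aut = record
      { 2≤r = 2≤r F
      ; steps = λ k → act-step {σ = σ} σ-aut (steps F k)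
      ; period = λ k → cong (σ ⟨$⟩ʳ_) (period F k)
      ; faithful = λ k i eq → faithful F k i (perm-injective σ eq) }

    phase-kM : ∀ k → phase b (k * M F) ≡ phase b k
    phase-kM zero = refl
    phase-kM (suc k) = begin
      phase b (M F + k * M F)        ≡⟨ cong (phase b) (+-comm (M F) (k * M F)) ⟩
      phase b (k * M F + M F)        ≡⟨ phase-+ b (k * M F) (M F) ⟩
      phase (phase b (M F)) (k * M F) ≡⟨ cong (λ c → phase c (k * M F)) (phase-M F) ⟩
      phase (not b) (k * M F)        ≡⟨ phase-not b (k * M F) ⟩
      not (phase b (k * M F))        ≡⟨ cong not (phase-kM k) ⟩
      not (phase b k)                ∎
      where open ≡-Reasoning

    -- The index `k * M F` stands for -k, since `M F` is -1 modulo `2 * r`.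
    reverse : Cycle r b (λ k → f (k * M F))
    reverse = record
      { 2≤r = 2≤r F
      ; steps = λ k → subst₂ (λ c x → Step c x (f (suc k * M F)))
          (trans (cong not (phase-kM (suc k))) (not-involutive (phase b k))) (previous k)
          (step-back F (suc k * M F))
      ; period = λ k → trans (cong f (trans (*-distribʳ-+ (M F) k (2 * r)) (cong (k * M F +_) (*-comm (2 * r) (M F)))))
          (periods F (k * M F) (M F))
      ; faithful = λ k i eq → ∣m+n∣m⇒∣n
          (subst (2 * r ∣_) (trans (sym (k+kM F k)) (+-comm k (k * M F))) (n∣m*n k))
          (faithful F (k * M F) (i * M F) (trans (cong f (sym (*-distribʳ-+ (M F) k i))) eq)) }
      where
      previous : ∀ k → f (suc (suc k * M F)) ≡ f (k * M F)
      previous k = trans (cong f (trans (cong (_+ k * M F) (M+1≡2r F)) (+-comm (2 * r) (k * M F))))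
        (period F (k * M F))

  -- Vertex-transitivity carries the two cycle edges at `f (suc k)`, both of the same direction
  -- there, to `y`.
  branch-at : ∀ {r b f} → Cycle r b f → ∀ k y →
              ∃[ p ] ∃[ q ] (p ≢ q × Step (phase b (suc k)) y p × Step (phase b (suc k)) y q)
  branch-at {f = f} F k y with proj₁ hat (f (suc k)) y
  ... | σ , σ-aut , refl = σ ⟨$⟩ʳ f k , σ ⟨$⟩ʳ f (suc (suc k)) , no-backtrack F k ∘ perm-injective σ ,
    act-step {σ = σ} σ-aut (step-back F k) , act-step {σ = σ} σ-aut (steps F (suc k))

  -- Positions -r and r agree modulo `2 * r`.
  reverse-antipode : ∀ {r b f} (F : Cycle r b f) → f (r * M F) ≡ f r
  reverse-antipode {zero} F = refl
  reverse-antipode {r@(suc r-1)} {f = f} F = begin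
    f (r * M F)             ≡⟨ cong f eq ⟩
    f (r + r-1 * (2 * r))   ≡⟨ periods F r r-1 ⟩
    f r                     ∎
    where
    open ≡-Reasoning
    eq : r * M F ≡ r + r-1 * (2 * r)
    eq = +-cancelˡ-≡ r _ _ (begin
      r + r * M F                ≡⟨ k+kM F r ⟩
      2 * r + r-1 * (2 * r)      ≡⟨ cong (_+ r-1 * (2 * r)) (cong (r +_) (+-identityʳ r)) ⟩
      r + r + r-1 * (2 * r)      ≡⟨ +-assoc r r _ ⟩
      r + (r + r-1 * (2 * r))    ∎)

  unshift : ∀ {r b f} (F : Cycle r b f) m k → f (k + m * M F + m) ≡ f k
  unshift {r} {f = f} F m k = begin
    f (k + m * M F + m)    ≡⟨ cong f (+-assoc k (m * M F) m) ⟩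
    f (k + (m * M F + m))  ≡⟨ cong (λ z → f (k + z)) (trans (+-comm (m * M F) m) (k+kM F m)) ⟩
    f (k + m * (2 * r))    ≡⟨ periods F k m ⟩
    f k                    ∎
    where open ≡-Reasoning

  -- Positions k and -k carry the same vertex, so `2 * r` divides -2k and `r` divides -k; `k+kM`
  -- passes from -k to `k`.
  self-opposite : ∀ {r b f} (F : Cycle r b f) k → f k ≡ f (k * M F) → r ∣ k
  self-opposite {r} F k eq = ∣m+n∣m⇒∣n
    (subst (r ∣_) (trans (sym (k+kM F k)) (+-comm k (k * M F))) (∣-trans (n∣m*n 2) (n∣m*n k)))
    (*-cancelˡ-∣ 2 (subst (2 * r ∣_) (cong (k * M F +_) (sym (+-identityʳ (k * M F))))
      (faithful F (k * M F + k * M F) k (trans (unshift F k (k * M F)) (sym eq)))))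

  -- Rigidity of alternating cycles

  Image : (ℕ → Fin n) → Fin n → Set
  Image f x = ∃[ k ] f k ≡ x

  EdgesDisjoint : (f g : ℕ → Fin n) → Set
  EdgesDisjoint f g = ∀ i j →
      ¬ (f i ≡ g j × f (suc i) ≡ g (suc j))
    × ¬ (f i ≡ g (suc j) × f (suc i) ≡ g j)

  module Alternating {r₁ f₁} (F₁ : Cycle r₁ true f₁) where

    -- The given cycle has a tail at position 2 and a head at position 1, whence the arguments 1 and
    -- 0.
    branch : ∀ b y → ∃[ p ] ∃[ q ] (p ≢ q × Step b y p × Step b y q)
    branch true  = branch-at F₁ 1
    branch false = branch-at F₁ 0

    -- Otherwise `p`, `q`, `s` and two neighbours of the opposite direction would be five neighbours
    -- of `y`.
    two-neighbours : ∀ {b y p q s} → Step b y p → Step b y q → Step b y s → p ≢ q → p ≢ s → q ≡ s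
    two-neighbours {b} {y} {p} {q} {s} yp yq ys p≢q p≢s with q ≟ s
    ... | yes q≡s = q≡s
    ... | no  q≢s with branch (not b) y
    ... | z , t , z≢t , yz , yt = ⊥-elim (no-five-neighbours (p ∷ q ∷ s ∷ z ∷ t ∷ [])
      ((p≢q ∷ p≢s ∷ step-asym yp yz ∷ step-asym yp yt ∷ [])
        ∷ (q≢s ∷ step-asym yq yz ∷ step-asym yq yt ∷ [])
        ∷ (step-asym ys yz ∷ step-asym ys yt ∷ [])
        ∷ (z≢t ∷ []) ∷ [] ∷ [])
      (step-edge yp ∷ step-edge yq ∷ step-edge ys ∷ step-edge yz ∷ step-edge yt ∷ []))

    -- At each vertex the cycle goes on to the one neighbour of the required direction that was not
    -- just visited.
    deterministic : ∀ {r s b f g} → Cycle r b f → Cycle s b g → f 0 ≡ g 0 → f 1 ≡ g 1 → ∀ k → f k ≡ g k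
    deterministic {b = b} {f} {g} F G eq₀ eq₁ k = proj₁ (both k)
      where
      both : ∀ k → f k ≡ g k × f (suc k) ≡ g (suc k)
      both zero = eq₀ , eq₁
      both (suc k) with both k
      ... | p , q = q , two-neighbours
        (step-back F k)
        (steps F (suc k))
        (subst (λ y → Step (phase b (suc k)) y (g (suc (suc k)))) (sym q) (steps G (suc k)))
        (no-backtrack F k)
        (no-backtrack G k ∘ trans (sym p))

    -- The common first vertex has only two neighbours in direction `b`, namely `g 1` and `g (M G)`,
    -- and `f` starts towards one of them.
    same-or-reverse : ∀ {r s b f g} → Cycle r b f → (G : Cycle s b g) → f 0 ≡ g 0 →
                      (∀ k → f k ≡ g k) ⊎ (∀ k → f k ≡ g (k * M G))
    same-or-reverse {s = s} {b} {f} {g} F G eq₀ with f 1 ≟ g 1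
    ... | yes eq₁ = inj₁ (deterministic F G eq₀ eq₁)
    ... | no  f₁≢g₁ = inj₂ (deterministic F (reverse G) eq₀ (two-neighbours
      (steps G 0)
      (subst (λ y → Step b y (f 1)) eq₀ (steps F 0))
      (steps (reverse G) 0)
      (f₁≢g₁ ∘ sym)
      λ eq → no-backtrack G (M G) (begin
        g (M G)              ≡⟨ cong g (*-identityˡ (M G)) ⟨
        g (1 * M G)          ≡⟨ eq ⟨
        g 1                  ≡⟨ period G 1 ⟨
        g (suc (2 * s))      ≡⟨ cong (g ∘ suc) (M+1≡2r G) ⟨
        g (suc (suc (M G)))  ∎)))
      where open ≡-Reasoning

    -- By vertex-transitivity and rigidity, `g` is an image of `f` or of its reverse, so the period
    -- of `g` is a period of `f`.
    radius-divides : ∀ {r s f g} → Cycle r true f → Cycle s true g → 2 * r ∣ 2 * s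
    radius-divides {r} {s} {f} {g} F G with proj₁ hat (f 0) (g 0)
    ... | σ , σ-aut , eq₀ with same-or-reverse G (act F {σ} σ-aut) (sym eq₀)
    ... | inj₁ same = faithful F (2 * s) 0 (trans (cong f (+-identityʳ _))
      (perm-injective σ (trans (sym (same (2 * s))) (trans (period G 0) (same 0)))))
    ... | inj₂ rev = faithful (reverse F) (2 * s) 0 (trans (cong (λ k → f (k * M F)) (+-identityʳ (2 * s)))
      (perm-injective σ (trans (sym (rev (2 * s))) (trans (period G 0) (rev 0)))))

    radius-unique : ∀ {r s f g} → Cycle r true f → Cycle s true g → r ≡ s
    radius-unique {r} {s} F G =
      *-cancelˡ-≡ r s 2 (∣-antisym (radius-divides F G) (radius-divides G F))

    -- The first vertex and its phase leave only the direction of traversal free, and reversal fixes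
    -- position `r`.
    same-antipode : ∀ {r b f g} → Cycle r b f → Cycle r b g → f 0 ≡ g 0 → f r ≡ g r
    same-antipode {r} F G eq₀ with same-or-reverse F G eq₀
    ... | inj₁ same = same r
    ... | inj₂ rev  = trans (rev r) (reverse-antipode G)

    act-image : ∀ {r b g h σ} → IsAut Γ σ → Cycle r b g → Cycle r b h → σ ⟨$⟩ʳ g 0 ≡ h 0 →
                ∀ k → Image h (σ ⟨$⟩ʳ g k)
    act-image {σ = σ} σ-aut G H eq₀ k with same-or-reverse (act G {σ} σ-aut) H eq₀
    ... | inj₁ same = k , sym (same k)
    ... | inj₂ rev  = k * M H , sym (rev k)

    -- With equal phases at a common vertex the cycles would agree from there on, forwards or in
    -- reverse, and share an edge.
    disjoint-phases : ∀ {r b c f g} → Cycle r b f → Cycle r c g → EdgesDisjoint f g →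
                      ∀ k j → f k ≡ g j → phase b k ≢ phase c j
    disjoint-phases {r} {b} {c} {f} {g} F G disjoint k j eq ph
      with same-or-reverse (shift F k) (subst (λ d → Cycle r d (λ i → g (i + j))) (sym ph) (shift G j)) eq
    ... | inj₁ same = proj₁ (disjoint k j) (eq , same 1)
    ... | inj₂ rev  = proj₂ (disjoint k (M G + j)) (before , trans (rev 1) (cong (λ z → g (z + j)) (*-identityˡ (M G))))
      where
      before : f k ≡ g (suc (M G + j))
      before = begin
        f k                ≡⟨ eq ⟩
        g j                ≡⟨ period G j ⟨
        g (j + 2 * r)      ≡⟨ cong g (+-comm j (2 * r)) ⟩
        g (2 * r + j)      ≡⟨ cong (λ z → g (z + j)) (M+1≡2r G) ⟨
        g (suc (M G + j))  ∎
        where open ≡-Reasoning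

    -- Attachment positions form a subgroup

    module Meeting {r f g} (F : Cycle r true f) (G : Cycle r false g)
      (meet : f 0 ≡ g 0) (disjoint : EdgesDisjoint f g) where

      -- A common vertex has opposite phases on the two cycles, and these also start with opposite
      -- phases.
      phases-agree : ∀ {k j} → f k ≡ g j → phase true k ≡ phase true j
      phases-agree {k} {j} eq = trans (¬-not (disjoint-phases F G disjoint k j eq)) (sym (phase-not false j))

      S : ℕ → Set
      S k = Image g (f k)

      S-resp : ∀ {k l} → f k ≡ f l → S k → S l
      S-resp eq (j , p) = j , trans p eq

      S-zero : S 0
      S-zero = 0 , sym meet

      -- The reflection of `f` in `f 0` fixes `g 0`, hence maps `g` to itself.
      S-neg : ∀ {k} → S k → S (k * M F)
      S-neg {k} (j , gj≡fk) with step-transitive {true} (steps F 0) (steps (reverse F) 0)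
      ... | σ , σ-aut , σ₀ , σ₁ = subst (Image g)
        (trans (cong (σ ⟨$⟩ʳ_) gj≡fk) (deterministic (act F {σ} σ-aut) (reverse F) σ₀ σ₁ k))
        (act-image {σ = σ} σ-aut G G (trans (cong (σ ⟨$⟩ʳ_) (sym meet)) (trans σ₀ meet)) j)

      -- The automorphism rotating f by l − k carries the two cycles through f k to those through f l,
      -- that is, preserves both cycles.
      S-rotate : ∀ {k l} t → phase true k ≡ phase true l → S k → S l → S (t + k) → S (t + l)
      S-rotate {k} {l} t ph (j , gj≡fk) (j′ , gj′≡fl) (m , gm≡ftk)
        with step-transitive (steps F k) (subst (λ b → Step b (f l) (f (suc l))) (sym ph) (steps F l))
      ... | σ , σ-aut , σ₀ , σ₁ = image
        where
        ph-g : phase false j ≡ phase false j′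
        ph-g = begin
          phase false j        ≡⟨ phase-not true j ⟩
          not (phase true j)   ≡⟨ cong not (phases-agree (sym gj≡fk)) ⟨
          not (phase true k)   ≡⟨ cong not ph ⟩
          not (phase true l)   ≡⟨ cong not (phases-agree (sym gj′≡fl)) ⟩
          not (phase true j′)  ≡⟨ phase-not true j′ ⟨
          phase false j′       ∎
          where open ≡-Reasoning
        rotated : σ ⟨$⟩ʳ f (t + k) ≡ f (t + l)
        rotated = deterministic (act (shift F k) {σ} σ-aut)
          (subst (λ b → Cycle r b (λ i → f (i + l))) (sym ph) (shift F l)) σ₀ σ₁ t
        image : S (t + l)
        image with act-image {σ = σ} σ-aut (shift G j)
          (subst (λ b → Cycle r b (λ i → g (i + j′))) (sym ph-g) (shift G j′))
          -- In `g` shifted by `j`, the vertex `g m` has index m - j.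
          (trans (cong (σ ⟨$⟩ʳ_) gj≡fk) (trans σ₀ (sym gj′≡fl))) (m + j * M G)
        ... | i , eq = i + j′ , trans eq
          (trans (cong (σ ⟨$⟩ʳ_) (trans (unshift G j m) gm≡ftk)) rotated)

      -- Rotations preserve phase, so an even summand serves as the rotation. For odd `k` and `l`,
      -- the rotation taking -k to `l` takes 0 to `k + l`.
      S-+ : ∀ k l → S k → S l → S (k + l)
      S-+ k l Sk Sl with phase true k in ph-k | phase true l in ph-l
      ... | true | _ = subst S (+-comm l k)
        (S-rotate l (sym ph-k) S-zero Sk (subst S (sym (+-identityʳ l)) Sl))
      ... | false | true = S-rotate k (sym ph-l) S-zero Sl (subst S (sym (+-identityʳ k)) Sk)
      ... | false | false = S-rotate k (trans (phase-kM F k) (trans ph-k (sym ph-l))) (S-neg Sk) Sl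
        (S-resp (sym (trans (cong f (k+kM F k)) (periods F 0 k))) S-zero)

      S-* : ∀ q {k} → S k → S (q * k)
      S-* zero Sk = S-zero
      S-* (suc q) {k} Sk = S-+ k (q * k) Sk (S-* q Sk)

      -- An odd multiple of `r` is `r` modulo `2 * r`.
      antipode-attached : ∀ {d} → 2 ∤ d → S d → S r
      antipode-attached {d} d-odd Sd with odd-form d-odd
      ... | q , refl = S-resp (trans (cong f eq) (periods F r q)) (S-* r Sd)
        where
        eq : r * (1 + 2 * q) ≡ r + q * (2 * r)
        eq = begin
          r * (1 + 2 * q)  ≡⟨ *-suc r (2 * q) ⟩
          r + r * (2 * q)  ≡⟨ cong (r +_) (*-assoc r 2 q) ⟨
          r + r * 2 * q    ≡⟨ cong (r +_) (*-comm (r * 2) q) ⟩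
          r + q * (r * 2)  ≡⟨ cong (λ z → r + q * z) (*-comm r 2) ⟩
          r + q * (2 * r)  ∎
          where open ≡-Reasoning

      -- A reflection of g at x fixes f r, whether it fixes f or reflects it; but its only
      -- fixed points on g are g 0 and g r.
      antipodes-coincide : S r → f r ≡ g r
      antipodes-coincide (m , gm≡fr) with step-transitive {false} (steps G 0) (steps (reverse G) 0)
      ... | σ , σ-aut , σ₀ , σ₁ with self-opposite G m fixed
        where
        fixed : g m ≡ g (m * M G)
        fixed = begin
          g m             ≡⟨ gm≡fr ⟩
          f r             ≡⟨ same-antipode (act F {σ} σ-aut) F
                               (trans (cong (σ ⟨$⟩ʳ_) meet) (trans σ₀ (sym meet))) ⟨
          σ ⟨$⟩ʳ f r      ≡⟨ cong (σ ⟨$⟩ʳ_) gm≡fr ⟨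
          σ ⟨$⟩ʳ g m      ≡⟨ deterministic (act G {σ} σ-aut) (reverse G) σ₀ σ₁ m ⟩
          g (m * M G)     ∎
          where open ≡-Reasoning
      ... | divides q refl with parity-cases q
      -- An even `q` would give `g m = g 0`, hence `f r = f 0`, although `r` lies strictly between 0
      -- and `2 * r`.
      ... | inj₁ (p , refl) = contradiction
        (faithful F r 0 (trans (cong f (+-identityʳ r)) (begin
          f r              ≡⟨ gm≡fr ⟨
          g (2 * p * r)    ≡⟨ cong g (trans (cong (_* r) (*-comm 2 p)) (*-assoc p 2 r)) ⟩
          g (p * (2 * r))  ≡⟨ periods G 0 p ⟩
          g 0              ≡⟨ meet ⟨
          f 0              ∎)))
        (>⇒∤ {{>-nonZero 0<r}} (m<m+n r (≤-trans 0<r (m≤m+n r 0))))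
        where
        open ≡-Reasoning
        0<r : 0 < r
        0<r = ≤-trans (s≤s z≤n) (2≤r F)
      ... | inj₂ (p , refl) = trans (sym gm≡fr) (trans
        (cong (λ z → g (r + z)) (trans (cong (_* r) (*-comm 2 p)) (*-assoc p 2 r)))
        (periods G r p))

      -- The antipodal map as an arc-reversing automorphism

      module Antipodal (r-odd : 2 ∤ r) (coincide : f r ≡ g r) where

        τ : Fin n → Fin n
        τ v = proj₁ (proj₁ hat (f 0) v) ⟨$⟩ʳ f r

        -- Independence of the automorphism chosen in `τ`: two images of `f` with the same first
        -- vertex have the same antipode.
        τ-act : ∀ {σ} → IsAut Γ σ → τ (σ ⟨$⟩ʳ f 0) ≡ σ ⟨$⟩ʳ f r
        τ-act {σ} σ-aut with proj₁ hat (f 0) (σ ⟨$⟩ʳ f 0)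
        ... | ρ , ρ-aut , eq = same-antipode (act F {ρ} ρ-aut) (act F {σ} σ-aut) eq

        -- As `r` is odd, `f r = g r` is a tail on `g`, so its antipode can be read off `g`: it is
        -- `g (2 * r) = f 0`.
        τ-involutive : ∀ v → τ (τ v) ≡ v
        τ-involutive v with proj₁ hat (f 0) v | proj₁ hat (f 0) (f r)
        ... | σ , σ-aut , refl | ρ , ρ-aut , ρ₀ = begin
          τ (σ ⟨$⟩ʳ f r)             ≡⟨ cong (λ z → τ (σ ⟨$⟩ʳ z)) ρ₀ ⟨
          τ (σ ⟨$⟩ʳ (ρ ⟨$⟩ʳ f 0))    ≡⟨ τ-act {ρ ∘ₚ σ} (aut-∘ Γ {ρ} {σ} ρ-aut σ-aut) ⟩
          σ ⟨$⟩ʳ (ρ ⟨$⟩ʳ f r)        ≡⟨ cong (σ ⟨$⟩ʳ_) (same-antipode (act F {ρ} ρ-aut) G-from-r (trans ρ₀ coincide)) ⟩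
          σ ⟨$⟩ʳ g (r + r)           ≡⟨ cong (λ z → σ ⟨$⟩ʳ g (r + z)) (+-identityʳ r) ⟨
          σ ⟨$⟩ʳ g (2 * r)           ≡⟨ cong (σ ⟨$⟩ʳ_) (trans (period G 0) (sym meet)) ⟩
          σ ⟨$⟩ʳ f 0                 ∎
          where
          open ≡-Reasoning
          G-from-r : Cycle r true (λ k → g (k + r))
          G-from-r = subst (λ b → Cycle r b (λ k → g (k + r))) (phase-odd false r-odd) (shift G r)

        -- Up to an automorphism the arc is `f 0 ⟶ f 1`. Its ends go to `f r` and `f (suc r)`, and
        -- at the odd position `r` the arc points backwards.
        τ-reverses : ∀ {u v} → u ⟶ v → τ v ⟶ τ u
        τ-reverses u⟶v with arc-transitive (steps F 0) u⟶v | proj₁ hat (f 0) (f 1)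
        ... | σ , σ-aut , refl , refl | ρ , ρ-aut , ρ₀ =
          subst₂ _⟶_ (sym τv) (sym (τ-act {σ} σ-aut))
            (act-arc {σ} σ-aut (subst (λ b → Step b (f r) (f (suc r))) (phase-odd true r-odd) (steps F r)))
          where
          open ≡-Reasoning
          τv : τ (σ ⟨$⟩ʳ f 1) ≡ σ ⟨$⟩ʳ f (suc r)
          τv = begin
            τ (σ ⟨$⟩ʳ f 1)           ≡⟨ cong (λ z → τ (σ ⟨$⟩ʳ z)) ρ₀ ⟨
            τ (σ ⟨$⟩ʳ (ρ ⟨$⟩ʳ f 0))  ≡⟨ τ-act {ρ ∘ₚ σ} (aut-∘ Γ {ρ} {σ} ρ-aut σ-aut) ⟩
            -- Since `f 1` is a head on `f`, the comparison of antipodes there needs a cycle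
            -- starting at a head, which `g` provides.
            σ ⟨$⟩ʳ (ρ ⟨$⟩ʳ f r)      ≡⟨ cong (λ z → σ ⟨$⟩ʳ (ρ ⟨$⟩ʳ z)) coincide ⟩
            σ ⟨$⟩ʳ (ρ ⟨$⟩ʳ g r)      ≡⟨ cong (σ ⟨$⟩ʳ_) (same-antipode (act G {ρ} ρ-aut) (shift F 1)
                                          (trans (cong (ρ ⟨$⟩ʳ_) (sym meet)) ρ₀)) ⟩
            σ ⟨$⟩ʳ f (r + 1)         ≡⟨ cong (λ z → σ ⟨$⟩ʳ f z) (+-comm r 1) ⟩
            σ ⟨$⟩ʳ f (suc r)         ∎

        τ-edge : ∀ {u v} → E Γ u v → E Γ (τ u) (τ v)
        τ-edge e with oriented e
        ... | inj₁ u⟶v = step-edge {false} (τ-reverses u⟶v)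
        ... | inj₂ v⟶u = arc-edge (τ-reverses v⟶u)

        τ-perm : Permutation′ n
        τ-perm = permutation τ τ τ-involutive τ-involutive

        τ-aut : IsAut Γ τ-perm
        τ-aut u v = mk⇔ τ-edge (subst₂ (E Γ) (τ-involutive u) (τ-involutive v) ∘ τ-edge)

        absurd : ⊥
        absurd = arc-asym (act-arc {τ-perm} τ-aut (steps F 0)) (τ-reverses (steps F 0))

      not-both-odd : ∀ {d} → S d → 2 ∤ d → 2 ∤ r → ⊥
      not-both-odd Sd d-odd r-odd =
        Antipodal.absurd r-odd (antipodes-coincide (antipode-attached d-odd Sd))

      -- The attachment number as an index

      module _ {a} (w : Fin a → Fin n) (w-inj : ∀ i j → w i ≡ w j → i ≡ j)
        (w-image : ∀ x → (Image f x × Image g x) ⇔ (∃[ i ] w i ≡ x)) where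

        S? : ∀ k → Dec (S k)
        S? k = mapDec (proj₂ ∘ from (w-image (f k))) (λ Sk → to (w-image (f k)) ((k , refl) , Sk))
          (any? λ i → w i ≟ f k)

        -- The common vertices are the `f k` with `d ∣ k`, where `d` generates `S`; they are counted
        -- over one period.
        attachment-index : ∃[ d ] (S d × a * d ≡ 2 * r)
        attachment-index with subgroup-generator S? (2 * r) (0<2r F) S-zero
          (S-resp (sym (period F 0)) S-zero) S-+ (λ k q → S-resp (periods F k q))
        ... | d , 0<d , Sd , generates with generates (2 * r) (S-resp (sym (period F 0)) S-zero)
        ... | divides e 2r≡ed = d , Sd , trans (cong (_* d) a≡e) (sym 2r≡ed)
          where
          position : ∀ i → ∃[ k ] (k < 2 * r × d ∣ k × f k ≡ w i)
          position i with from (w-image (w i)) (i , refl)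
          ... | (k , fk≡wi) , j , gj≡wi with reduce F k
          ... | l , l<2r , fl≡fk = l , l<2r , generates l (j , trans gj≡wi (sym fl≡wi)) , fl≡wi
            where
            fl≡wi : f l ≡ w i
            fl≡wi = trans fl≡fk fk≡wi

          a≡e : a ≡ e
          a≡e = count-multiples f w d e {{>-nonZero 0<d}} 2r≡ed (injective F) (λ {i} {j} → w-inj i j)
            (λ q → to (w-image _) ((q * d , refl) , S-* q Sd)) position

        attachment-radius : (2 ∤ r → a ∣ r) × (4 ∤ a → a ∣ r)
        attachment-radius = let (_ , Sd , ad≡2r) = attachment-index in dichotomy ad≡2r (not-both-odd Sd)

  -- From `AltCycle` data to the conclusion

  module _ {r : ℕ} (C : AltCycle Γ u₀ v₀ r) where
    open AltCycle C renaming (periodic to periodic-c; inj to inj-c)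

    cycle : Cycle r true c
    cycle = record
      { 2≤r = r≥2
      ; steps = alternate
      ; period = periodic-c
      ; faithful = periodic-faithful c {{>-nonZero (≤-trans (s≤s z≤n) (*-monoʳ-≤ 2 r≥2))}}
          periodic-c inj-c }
      where
      alternate : ∀ k → Step (phase true k) (c k) (c (suc k))
      alternate k with parity-cases k
      ... | inj₁ (q , refl) =
        subst (λ b → Step b (c (2 * q)) (c (suc (2 * q)))) (sym (phase-even true q)) (fwd q)
      ... | inj₂ (q , refl) =
        subst (λ b → Step b (c (suc (2 * q))) (c (suc (suc (2 * q))))) (cong not (sym (phase-even true q))) (bwd q)

    onCycle⇔image : ∀ i x → OnCycle Γ C x ⇔ Image (λ k → c (k + i)) x
    onCycle⇔image i x = mk⇔
      (λ (k , _ , ck≡x) → k + i * M cycle , trans (unshift cycle i k) ck≡x)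
      (λ (k , eq) → let (l , l<2r , cl≡) = reduce cycle (k + i) in l , l<2r , trans cl≡ eq)

  module _ {r a : ℕ} (C D : AltCycle Γ u₀ v₀ r) (disjoint : EdgeDisjoint Γ C D)
    (w : Fin a → Fin n) (w-inj : ∀ i j → w i ≡ w j → i ≡ j)
    (w-image : ∀ x → (OnCycle Γ C x × OnCycle Γ D x) ⇔ (∃[ i ] w i ≡ x)) where

    -- Both cycles are shifted to start at the common vertex, which edge-disjointness makes a head
    -- on `D`.
    attachment-radius-tail : ∀ i j → AltCycle.c C i ≡ AltCycle.c D j →
      phase true i ≡ true → (2 ∤ r → a ∣ r) × (4 ∤ a → a ∣ r)
    attachment-radius-tail i j eq tail = Alternating.Meeting.attachment-radius (cycle C)
      (subst (λ b → Cycle r b (λ k → AltCycle.c C (k + i))) tail (shift (cycle C) i))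
      (subst (λ b → Cycle r b (λ k → AltCycle.c D (k + j))) head (shift (cycle D) j))
      eq (λ k l → disjoint (k + i) (l + j)) w w-inj
      (λ x → mk⇔
        (λ (p , q) → to (w-image x) (from (onCycle⇔image C i x) p , from (onCycle⇔image D j x) q))
        (λ h → let (p , q) = from (w-image x) h in
          to (onCycle⇔image C i x) p , to (onCycle⇔image D j x) q))
      where
      head : phase true j ≡ false
      head = ¬-not λ tail′ → Alternating.disjoint-phases (cycle C) (cycle C) (cycle D) disjoint i j eq
        (trans tail (sym tail′))

theorem1p2 : ∀ {n} (Γ : Graph n) → Tetravalent Γ → HalfArcTransitive Γ →
    ∀ (u₀ v₀ : Fin n) → E Γ u₀ v₀ → ∀ (r a : ℕ) →
    IsRadius Γ u₀ v₀ r → IsAttachment Γ u₀ v₀ a →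
    ((¬ 2 ∣ r) → a ∣ r) × ((¬ 4 ∣ a) → a ∣ r)
theorem1p2 Γ tetravalent hat u₀ v₀ e₀ r a R
  (s , C , D , disjoint , (x , (i , _ , Ci≡x) , (j , _ , Dj≡x)) , w , w-inj , w-image)
  -- The attachment data carries its own radius `s`; uniqueness identifies it with `r`.
  with Orientation.Alternating.radius-unique Γ tetravalent hat u₀ v₀ e₀
    (Orientation.cycle Γ tetravalent hat u₀ v₀ e₀ R)
    (Orientation.cycle Γ tetravalent hat u₀ v₀ e₀ R)
    (Orientation.cycle Γ tetravalent hat u₀ v₀ e₀ C)
... | refl = conclude
  where
  open Orientation Γ tetravalent hat u₀ v₀ e₀
  open AltCycle using (c)

  Ci≡Dj : c C i ≡ c D j
  Ci≡Dj = trans Ci≡x (sym Dj≡x)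

  swapped : EdgeDisjoint Γ D C
  swapped l k = (λ (p , q) → proj₁ (disjoint k l) (sym p , sym q)) ,
                (λ (p , q) → proj₂ (disjoint k l) (sym q , sym p))

  conclude : ((¬ 2 ∣ r) → a ∣ r) × ((¬ 4 ∣ a) → a ∣ r)
  -- The cycle on which the common vertex is a tail takes the first place; the vertex cannot be a
  -- head on both.
  conclude with phase true i in ph-i | phase true j in ph-j
  ... | true  | _ = attachment-radius-tail C D disjoint w w-inj w-image i j Ci≡Dj ph-i
  ... | false | true = attachment-radius-tail D C swapped w w-inj
    (λ y → mk⇔ (λ (p , q) → to (w-image y) (q , p)) (λ h → let (p , q) = from (w-image y) h in q , p))
    j i (sym Ci≡Dj) ph-j
  ... | false | false = ⊥-elim (Alternating.disjoint-phases (cycle C) (cycle C) (cycle D) disjoint i j Ci≡Dj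
    (trans ph-i (sym ph-j)))
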